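{- Let $\varphi_1:\mathbb{N}\to\mathbb{N}$ be the function defined as follows. The values $\varphi_1(0),\varphi_1(1),\dots,\varphi_1(13)$ are, in order, $$2,3,0,1,5,4,9,8,7,6,13,12,11,10.$$ (1) If $7\cdot 2^{2n-1}\le x<7\cdot 2^{2n}$ for some integer $n\ge 1$, then $\varphi_1(x)=x\oplus 1$. (2) If $7\cdot 2^{2n}\le x<7\cdot 2^{2n+1}$ for some integer $n\ge1$, then $\varphi_1(x)=x\oplus 3$. Then, for all nonnegative integers $a,b$, the Halve Nim position $a^1b^11^1$ is a $\mathcal{P}$-position if and only if $b=\varphi_1(a)$. Furthermore, for $a,b\ge 14$, $a^1b^11^1$ is a $\mathcal{P}$-position if and only if $$a\oplus b=2+(-1)^{\lfloor\log_2(a/7)\rfloor}.$$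
   Context: $\mathbb{N}$ is the set of nonnegative integers and $\oplus$ denotes bitwise XOR. Halve Nim is a two-player game played on finitely many piles of coins; players alternate moves and a player who cannot move loses. A move is one of: (i) choose one pile and remove at least one coin from it; (ii) halve the game: simultaneously replace every pile of $m$ coins by a pile of $\lfloor m/2\rfloor$ coins. When there are no coins left, no move is available (halving requires at least one coin to be present). A position is a $\mathcal{P}$-position if the player who is not about to move has a winning strategy (equivalently, every move from it leads to an $\mathcal{N}$-position), and an $\mathcal{N}$-position if the player about to move has a winning strategy. $a^1b^1c^1$ denotes the position with three piles of sizes $a$, $b$, $c$ (a pile of size $0$ is an empty pile); in particular $a^1b^11^1$ has piles of sizes $a$, $b$, $1$. -}

module Defs where

open import Data.List.Base using (List; []; _∷_; map; upTo)
open import Data.List.Relation.Unary.Any using (Any)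
open import Data.Nat.Base
open import Data.Nat.DivMod
open import Data.Nat.Logarithm
  using (⌊log₂_⌋; ⌊log₂⌋-mono-≤; ⌊log₂⌊n/2⌋⌋≡⌊log₂n⌋∸1; ⌊log₂[2^n]⌋≡n)
open import Data.Nat.Properties
open import Data.Product.Base using (_×_; _,_)
open import Relation.Binary.PropositionalEquality

------------------------------------------------------------------------
-- Halve Nim

-- The piles are kept in a list; their order plays no role in the moves.
Position : Set
Position = List ℕ

infix 4 _⟶ᵗ_ _⟶_

data _⟶ᵗ_ : Position → Position → Set where
  here  : ∀ {m n ps} → m < n → n ∷ ps ⟶ᵗ m ∷ ps
  there : ∀ {n ps qs} → ps ⟶ᵗ qs → n ∷ ps ⟶ᵗ n ∷ qs

data _⟶_ : Position → Position → Set where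
  take  : ∀ {ps qs} → ps ⟶ᵗ qs → ps ⟶ qs
  halve : ∀ {ps} → Any (0 <_) ps → ps ⟶ map ⌊_/2⌋ ps

-- An inhabitant is a winning strategy, for the player who is not about
-- to move (P-position) or who is about to move (N-position).
mutual
  data P-position (ps : Position) : Set where
    allMovesToN : (∀ {qs} → ps ⟶ qs → N-position qs) → P-position ps

  data N-position (ps : Position) : Set where
    someMoveToP : ∀ {qs} → ps ⟶ qs → P-position qs → N-position ps

------------------------------------------------------------------------
-- Bitwise exclusive or

infixl 6 _⊕_

-- The lowest bit of the result is (m + n) % 2, the sum modulo 2 of the
-- lowest bits of m and n.  The first argument bounds the number of bits
-- treated; ⊕-unfold shows that m + n is always enough.
xorBits : ℕ → ℕ → ℕ → ℕ
xorBits zero    m n = 0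
xorBits (suc k) m n = (m + n) % 2 + 2 * xorBits k ⌊ m /2⌋ ⌊ n /2⌋

_⊕_ : ℕ → ℕ → ℕ
m ⊕ n = xorBits (m + n) m n

xorBits-0 : ∀ k → xorBits k 0 0 ≡ 0
xorBits-0 zero    = refl
xorBits-0 (suc k) rewrite xorBits-0 k = refl

halves-≤ : ∀ m n {k} → m + n ≤ suc k → ⌊ m /2⌋ + ⌊ n /2⌋ ≤ k
halves-≤ zero    zero    _       = z≤n
halves-≤ zero    (suc n) (s≤s p) = ≤-trans (≤-pred (⌊n/2⌋<n n)) p
halves-≤ (suc m) n       (s≤s p) =
  ≤-trans (+-mono-≤ (≤-pred (⌊n/2⌋<n m)) (⌊n/2⌋≤n n)) p

xorBits-stable : ∀ j k m n → m + n ≤ j → m + n ≤ k →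
                 xorBits j m n ≡ xorBits k m n
xorBits-stable zero    k       zero zero _ _ = sym (xorBits-0 k)
xorBits-stable (suc j) zero    zero zero _ _ = xorBits-0 (suc j)
xorBits-stable (suc j) (suc k) m    n    p q =
  cong (λ r → (m + n) % 2 + 2 * r)
    (xorBits-stable j k ⌊ m /2⌋ ⌊ n /2⌋ (halves-≤ m n p) (halves-≤ m n q))

⊕-unfold : ∀ m n → m ⊕ n ≡ (m + n) % 2 + 2 * (⌊ m /2⌋ ⊕ ⌊ n /2⌋)
⊕-unfold m n = trans
  (xorBits-stable (m + n) (suc (m + n)) m n ≤-refl (n≤1+n _))
  (cong (λ r → (m + n) % 2 + 2 * r)
    (xorBits-stable (m + n) (⌊ m /2⌋ + ⌊ n /2⌋) ⌊ m /2⌋ ⌊ n /2⌋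
      (+-mono-≤ (⌊n/2⌋≤n m) (⌊n/2⌋≤n n)) ≤-refl))

------------------------------------------------------------------------
-- Logarithms

-- ⌊log₂ (a/7)⌋ for the rational number a/7, where a ≥ 7.  Since powers of
-- two are integers, a/7 may be rounded down first; ⌊log₂[a/7]⌋-spec and
-- ⌊log₂[a/7]⌋-unique confirm that this is the k with
-- 2 ^ k ≤ a/7 < 2 ^ (k + 1).
⌊log₂[_/7]⌋ : ℕ → ℕ
⌊log₂[ a /7]⌋ = ⌊log₂ (a / 7) ⌋

⌊log₂⌋-< : ∀ k n → n < 2 ^ suc k → ⌊log₂ n ⌋ ≤ k
⌊log₂⌋-< zero    n p = ⌊log₂⌋-mono-≤ (≤-pred p)
⌊log₂⌋-< (suc k) n p = m∸n≤o⇒m≤1+o (subst (_≤ k) (⌊log₂⌊n/2⌋⌋≡⌊log₂n⌋∸1 n)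
    (⌊log₂⌋-< k ⌊ n /2⌋ half<))
  where
  m∸n≤o⇒m≤1+o : ∀ {m o} → m ∸ 1 ≤ o → m ≤ suc o
  m∸n≤o⇒m≤1+o {zero}  _ = z≤n
  m∸n≤o⇒m≤1+o {suc m} q = s≤s q

  half< : ⌊ n /2⌋ < 2 ^ suc k
  half< = *-cancelˡ-< 2 _ _ (≤-<-trans
    (≤-trans (+-monoʳ-≤ ⌊ n /2⌋ (≤-trans (≤-reflexive (+-identityʳ _)) (⌊n/2⌋≤⌈n/2⌉ n)))
             (≤-reflexive (⌊n/2⌋+⌈n/2⌉≡n n))) p)

⌊log₂⌋-≥ : ∀ k n → 2 ^ k ≤ n → k ≤ ⌊log₂ n ⌋
⌊log₂⌋-≥ k n p = subst (_≤ ⌊log₂ n ⌋) (⌊log₂[2^n]⌋≡n k) (⌊log₂⌋-mono-≤ p)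

2^⌊log₂⌋≤ : ∀ n → 1 ≤ n → 2 ^ ⌊log₂ n ⌋ ≤ n
2^⌊log₂⌋≤ n 1≤n = go ⌊log₂ n ⌋ refl
  where
  go : ∀ k → ⌊log₂ n ⌋ ≡ k → 2 ^ k ≤ n
  go zero    _  = 1≤n
  go (suc k) eq = ≮⇒≥ λ p → 1+n≰n (subst (_≤ k) eq (⌊log₂⌋-< k n p))

<2^1+⌊log₂⌋ : ∀ n → n < 2 ^ suc ⌊log₂ n ⌋
<2^1+⌊log₂⌋ n = ≰⇒> λ p → 1+n≰n (⌊log₂⌋-≥ (suc ⌊log₂ n ⌋) n p)

7*≤⇒≤/7 : ∀ {m a} → 7 * m ≤ a → m ≤ a / 7
7*≤⇒≤/7 {m} {a} p = subst (_≤ a / 7) (m*n/n≡m m 7)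
  (/-monoˡ-≤ 7 (≤-trans (≤-reflexive (*-comm m 7)) p))

≤/7⇒7*≤ : ∀ {m a} → m ≤ a / 7 → 7 * m ≤ a
≤/7⇒7*≤ {m} {a} p = ≤-trans (*-monoʳ-≤ 7 p)
  (≤-trans (≤-reflexive (*-comm 7 (a / 7))) (m/n*n≤m a 7))

⌊log₂[a/7]⌋-spec : ∀ a → 7 ≤ a →
  7 * 2 ^ ⌊log₂[ a /7]⌋ ≤ a × a < 7 * 2 ^ suc ⌊log₂[ a /7]⌋
⌊log₂[a/7]⌋-spec a 7≤a =
  ≤/7⇒7*≤ (2^⌊log₂⌋≤ (a / 7) (7*≤⇒≤/7 7≤a)) ,
  ≰⇒> (λ p → <⇒≱ (<2^1+⌊log₂⌋ (a / 7)) (7*≤⇒≤/7 p))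

⌊log₂[a/7]⌋-unique : ∀ a k → 7 * 2 ^ k ≤ a → a < 7 * 2 ^ suc k →
                     ⌊log₂[ a /7]⌋ ≡ k
⌊log₂[a/7]⌋-unique a k p q = ≤-antisym
  (⌊log₂⌋-< k (a / 7) (≰⇒> λ r → <⇒≱ q (≤/7⇒7*≤ r)))
  (⌊log₂⌋-≥ k (a / 7) (7*≤⇒≤/7 p))

------------------------------------------------------------------------
-- The function φ₁

-- The ranges in xor-1 and xor-3 partition the integers ≥ 14, so this
-- determines φ at every argument.  As n ≥ 1, the subtraction
-- 2 * n ∸ 1 is never truncated.
record Isφ₁ (φ : ℕ → ℕ) : Set where
  field
    initial : map φ (upTo 14) ≡
              2 ∷ 3 ∷ 0 ∷ 1 ∷ 5 ∷ 4 ∷ 9 ∷ 8 ∷ 7 ∷ 6 ∷ 13 ∷ 12 ∷ 11 ∷ 10 ∷ []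
    xor-1   : ∀ n x → n ≥ 1 → 7 * 2 ^ (2 * n ∸ 1) ≤ x → x < 7 * 2 ^ (2 * n) →
              φ x ≡ x ⊕ 1
    xor-3   : ∀ n x → n ≥ 1 → 7 * 2 ^ (2 * n) ≤ x → x < 7 * 2 ^ (2 * n + 1) →
              φ x ≡ x ⊕ 3

-- Existence: Isφ₁ is satisfiable.

φ₁-large : ℕ → ℕ → ℕ
φ₁-large zero    x = x ⊕ 3
φ₁-large (suc _) x = x ⊕ 1

φ₁ : ℕ → ℕ
φ₁ 0  = 2
φ₁ 1  = 3
φ₁ 2  = 0
φ₁ 3  = 1
φ₁ 4  = 5
φ₁ 5  = 4
φ₁ 6  = 9
φ₁ 7  = 8
φ₁ 8  = 7
φ₁ 9  = 6
φ₁ 10 = 13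
φ₁ 11 = 12
φ₁ 12 = 11
φ₁ 13 = 10
φ₁ x  = φ₁-large (⌊log₂[ x /7]⌋ % 2) x

φ₁-≥14 : ∀ x → 14 ≤ x → φ₁ x ≡ φ₁-large (⌊log₂[ x /7]⌋ % 2) x
φ₁-≥14 _ (s≤s (s≤s (s≤s (s≤s (s≤s (s≤s (s≤s (s≤s (s≤s (s≤s (s≤s (s≤s (s≤s (s≤s _)))))))))))))) = refl

φ₁-range : ∀ k x → 1 ≤ k → 7 * 2 ^ k ≤ x → x < 7 * 2 ^ suc k →
           φ₁ x ≡ φ₁-large (k % 2) x
φ₁-range k x 1≤k p q = trans
  (φ₁-≥14 x (≤-trans (*-monoʳ-≤ 7 (^-monoʳ-≤ 2 1≤k)) p))
  (cong (λ j → φ₁-large (j % 2) x) (⌊log₂[a/7]⌋-unique x k p q))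

φ₁-Isφ₁ : Isφ₁ φ₁
φ₁-Isφ₁ = record { initial = refl ; xor-1 = odd ; xor-3 = even }
  where
  odd : ∀ n x → n ≥ 1 → 7 * 2 ^ (2 * n ∸ 1) ≤ x → x < 7 * 2 ^ (2 * n) →
        φ₁ x ≡ x ⊕ 1
  odd (suc m) x _ p q = trans
    (φ₁-range (2 * suc m ∸ 1) x (≤-trans (s≤s z≤n) (m≤n+m (suc (m + 0)) m)) p q)
    (cong (λ j → φ₁-large j x) (trans
      (cong (_% 2) (trans (+-suc m (m + 0)) (cong suc (*-comm 2 m))))
      ([m+kn]%n≡m%n 1 m 2)))

  even : ∀ n x → n ≥ 1 → 7 * 2 ^ (2 * n) ≤ x → x < 7 * 2 ^ (2 * n + 1) →
         φ₁ x ≡ x ⊕ 3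
  even n x n≥1 p q = trans
    (φ₁-range (2 * n) x (≤-trans n≥1 (m≤m+n n (n + 0))) p
      (subst (λ j → x < 7 * 2 ^ j) (+-comm (2 * n) 1) q))
    (cong (λ j → φ₁-large j x)
      (trans (cong (_% 2) (*-comm 2 n)) (m*n%n≡0 n 2)))

{-# OPTIONS --safe #-}
module Submission where

open import Defs
open import Data.Integer.Base as ℤ using (+_; -1ℤ)
import Data.Integer.Properties as ℤ
open import Data.List.Base using ([]; _∷_; map)
open import Data.List.Membership.Propositional using (_∈_)
open import Data.List.Membership.Propositional.Properties using (∈-upTo⁺)
open import Data.List.Properties using (∷-injectiveˡ; ∷-injectiveʳ)
open import Data.List.Relation.Unary.Any using (Any; here; there)
open import Data.Nat.Base
open import Data.Nat.DivMod
open import Data.Nat.Induction using (<-wellFounded)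
open import Data.Nat.Properties
open import Data.Nat.Tactic.RingSolver using (solve-∀)
open import Data.Product.Base using (_×_; _,_; ∃; proj₁; proj₂)
open import Data.Sum.Base using (_⊎_; inj₁; inj₂)
open import Function.Base using (_∘_)
open import Function.Bundles using (_⇔_; mk⇔)
open import Function.Construct.Composition using (_⇔-∘_)
open import Induction.WellFounded using (Acc; acc)
open import Relation.Binary.Definitions using (tri<; tri≈; tri>)
open import Relation.Binary.PropositionalEquality
open import Relation.Nullary using (yes; no; ¬_; contradiction)
open import Relation.Nullary.Decidable using (from-yes; ¬?; _→-dec_; _⊎-dec_)

-- Let φ be an involution, and suppose the 𝒫-positions with smaller first
-- two piles and third pile c are those with b ≡ φ a.  Then b ≡ φ a
-- characterises them at (a , b) too, provided that halving, or taking from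
-- the third pile, never leads from (a , φ a) to a 𝒫-position, but does lead
-- to one from (a , b) when b < φ a and a < φ b: in every other case with
-- b ≢ φ a, one of the first two piles can be lowered to reach the graph of φ.
-- For c = 0 this holds with φ₀, for c = 1 with φ₁ (whose moves out of c = 1
-- are judged by φ₀).  Below 28 both are verified by computation; above, φ₀
-- and φ₁ only change the two lowest bits, by a mask that alternates with
-- ⌊log₂ (x/7)⌋, and halving lowers that logarithm by one.

-- Exclusive or

⌊r+m*2/2⌋ : ∀ r m → ⌊ r + m * 2 /2⌋ ≡ ⌊ r /2⌋ + m
⌊r+m*2/2⌋ 0             zero    = refl
⌊r+m*2/2⌋ 0             (suc m) = cong suc (⌊r+m*2/2⌋ 0 m)
⌊r+m*2/2⌋ 1             zero    = refl
⌊r+m*2/2⌋ 1             (suc m) = cong suc (⌊r+m*2/2⌋ 1 m)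
⌊r+m*2/2⌋ (suc (suc r)) m       = cong suc (⌊r+m*2/2⌋ r m)

shift-doubled : ∀ a b c → a + 2 * (c + b) ≡ 2 * c + (a + 2 * b)
shift-doubled = solve-∀

n%2+2*⌊n/2⌋≡n : ∀ n → n % 2 + 2 * ⌊ n /2⌋ ≡ n
n%2+2*⌊n/2⌋≡n 0             = refl
n%2+2*⌊n/2⌋≡n 1             = refl
n%2+2*⌊n/2⌋≡n (suc (suc n)) =
  trans (shift-doubled (n % 2) ⌊ n /2⌋ 1) (cong (_+_ 2) (n%2+2*⌊n/2⌋≡n n))

⌊n%2/2⌋≡0 : ∀ n → ⌊ n % 2 /2⌋ ≡ 0
⌊n%2/2⌋≡0 0             = refl
⌊n%2/2⌋≡0 1             = refl
⌊n%2/2⌋≡0 (suc (suc n)) = ⌊n%2/2⌋≡0 n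

⌊[m⊕n]/2⌋ : ∀ m n → ⌊ m ⊕ n /2⌋ ≡ ⌊ m /2⌋ ⊕ ⌊ n /2⌋
⌊[m⊕n]/2⌋ m n = begin
  ⌊ m ⊕ n /2⌋                  ≡⟨ cong ⌊_/2⌋ (⊕-unfold m n) ⟩
  ⌊ (m + n) % 2 + 2 * h /2⌋    ≡⟨ cong (λ j → ⌊ (m + n) % 2 + j /2⌋) (*-comm 2 h) ⟩
  ⌊ (m + n) % 2 + h * 2 /2⌋    ≡⟨ ⌊r+m*2/2⌋ ((m + n) % 2) h ⟩
  ⌊ (m + n) % 2 /2⌋ + h        ≡⟨ cong (_+ h) (⌊n%2/2⌋≡0 (m + n)) ⟩
  h                            ∎
  where
  open ≡-Reasoning
  h = ⌊ m /2⌋ ⊕ ⌊ n /2⌋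

[m⊕n]%2 : ∀ m n → (m ⊕ n) % 2 ≡ (m + n) % 2
[m⊕n]%2 m n = begin
  (m ⊕ n) % 2                  ≡⟨ cong (_% 2) (⊕-unfold m n) ⟩
  ((m + n) % 2 + 2 * h) % 2    ≡⟨ cong (λ j → ((m + n) % 2 + j) % 2) (*-comm 2 h) ⟩
  ((m + n) % 2 + h * 2) % 2    ≡⟨ [m+kn]%n≡m%n ((m + n) % 2) h 2 ⟩
  (m + n) % 2 % 2              ≡⟨ m%n%n≡m%n (m + n) 2 ⟩
  (m + n) % 2                  ∎
  where
  open ≡-Reasoning
  h = ⌊ m /2⌋ ⊕ ⌊ n /2⌋

-- Bit by bit: the lowest bit is the parity of `m + (m + n)`, and the halves satisfy the same
-- identity. In `go`, the bound `k` on `m + n` makes the recursion structural.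
m⊕[m⊕n]≡n : ∀ m n → m ⊕ (m ⊕ n) ≡ n
m⊕[m⊕n]≡n m n = go (m + n) m n ≤-refl
  where
  open ≡-Reasoning

  lowest : ∀ m n → (m + (m ⊕ n)) % 2 ≡ n % 2
  lowest m n = begin
    (m + (m ⊕ n)) % 2              ≡⟨ %-distribˡ-+ m (m ⊕ n) 2 ⟩
    (m % 2 + (m ⊕ n) % 2) % 2      ≡⟨ cong (λ j → (m % 2 + j) % 2) ([m⊕n]%2 m n) ⟩
    (m % 2 + (m + n) % 2) % 2      ≡⟨ %-distribˡ-+ m (m + n) 2 ⟨
    (m + (m + n)) % 2              ≡⟨ cong (_% 2) (regroup m n) ⟩
    (n + m * 2) % 2                ≡⟨ [m+kn]%n≡m%n n m 2 ⟩
    n % 2                          ∎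
    where
    regroup : ∀ m n → m + (m + n) ≡ n + m * 2
    regroup = solve-∀

  go : ∀ k m n → m + n ≤ k → m ⊕ (m ⊕ n) ≡ n
  go zero    zero zero _ = refl
  go (suc k) m    n    p = begin
    m ⊕ (m ⊕ n)                                          ≡⟨ ⊕-unfold m (m ⊕ n) ⟩
    (m + (m ⊕ n)) % 2 + 2 * (⌊ m /2⌋ ⊕ ⌊ m ⊕ n /2⌋)      ≡⟨ cong₂ (λ i j → i + 2 * (⌊ m /2⌋ ⊕ j))
                                                              (lowest m n) (⌊[m⊕n]/2⌋ m n) ⟩
    n % 2 + 2 * (⌊ m /2⌋ ⊕ (⌊ m /2⌋ ⊕ ⌊ n /2⌋))          ≡⟨ cong (λ j → n % 2 + 2 * j)
                                                              (go k ⌊ m /2⌋ ⌊ n /2⌋ (halves-≤ m n p)) ⟩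
    n % 2 + 2 * ⌊ n /2⌋                                  ≡⟨ n%2+2*⌊n/2⌋≡n n ⟩
    n                                                    ∎

⊕-identityʳ : ∀ m → m ⊕ 0 ≡ m
⊕-identityʳ m = go m m ≤-refl
  where
  go : ∀ k m → m ≤ k → m ⊕ 0 ≡ m
  go zero    zero    _       = refl
  go (suc k) zero    _       = refl
  go (suc k) (suc m) (s≤s p) = trans (⊕-unfold (suc m) 0) (trans
    (cong₂ (λ i j → i % 2 + 2 * j) (+-identityʳ (suc m))
      (go k ⌊ suc m /2⌋ (≤-trans (≤-pred (⌊n/2⌋<n m)) p)))
    (n%2+2*⌊n/2⌋≡n (suc m)))

m⊕2≢m : ∀ m → m ⊕ 2 ≢ m
m⊕2≢m m eq = 2≢0 (begin
  2              ≡⟨ m⊕[m⊕n]≡n m 2 ⟨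
  m ⊕ (m ⊕ 2)    ≡⟨ cong (m ⊕_) (trans eq (sym (⊕-identityʳ m))) ⟩
  m ⊕ (m ⊕ 0)    ≡⟨ m⊕[m⊕n]≡n m 0 ⟩
  0              ∎)
  where
  open ≡-Reasoning
  2≢0 : 2 ≢ 0
  2≢0 ()

[2+m]⊕n : ∀ m {n} → n < 2 → (2 + m) ⊕ n ≡ 2 + (m ⊕ n)
[2+m]⊕n m {n} n<2 = begin
  (2 + m) ⊕ n                                    ≡⟨ ⊕-unfold (2 + m) n ⟩
  (m + n) % 2 + 2 * (suc ⌊ m /2⌋ ⊕ ⌊ n /2⌋)      ≡⟨ cong (λ j → (m + n) % 2 + 2 * j) (trans
                                                      (⊕0 (suc ⌊ m /2⌋)) (cong suc (sym (⊕0 ⌊ m /2⌋)))) ⟩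
  (m + n) % 2 + 2 * suc (⌊ m /2⌋ ⊕ ⌊ n /2⌋)      ≡⟨ shift-doubled ((m + n) % 2) _ 1 ⟩
  2 + ((m + n) % 2 + 2 * (⌊ m /2⌋ ⊕ ⌊ n /2⌋))    ≡⟨ cong (_+_ 2) (⊕-unfold m n) ⟨
  2 + (m ⊕ n)                                    ∎
  where
  open ≡-Reasoning
  ⊕0 : ∀ k → k ⊕ ⌊ n /2⌋ ≡ k
  ⊕0 k = trans (cong (k ⊕_) (n≤0⇒n≡0 (⌊n/2⌋-mono (≤-pred n<2)))) (⊕-identityʳ k)

[4+m]⊕n : ∀ m {n} → n < 4 → (4 + m) ⊕ n ≡ 4 + (m ⊕ n)
[4+m]⊕n m {n} n<4 = begin
  (4 + m) ⊕ n                                      ≡⟨ ⊕-unfold (4 + m) n ⟩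
  (m + n) % 2 + 2 * ((2 + ⌊ m /2⌋) ⊕ ⌊ n /2⌋)      ≡⟨ cong (λ j → (m + n) % 2 + 2 * j)
                                                        ([2+m]⊕n ⌊ m /2⌋ (s≤s (⌊n/2⌋-mono (≤-pred n<4)))) ⟩
  (m + n) % 2 + 2 * (2 + (⌊ m /2⌋ ⊕ ⌊ n /2⌋))      ≡⟨ shift-doubled ((m + n) % 2) _ 2 ⟩
  4 + ((m + n) % 2 + 2 * (⌊ m /2⌋ ⊕ ⌊ n /2⌋))      ≡⟨ cong (_+_ 4) (⊕-unfold m n) ⟨
  4 + (m ⊕ n)                                      ∎
  where open ≡-Reasoning

-- A mask below 4 acts inside a block of four consecutive numbers. The form `q * 2 * 2` lets
-- `⌊r+m*2/2⌋` apply directly when such a number is halved.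
[r+q*2*2]⊕n : ∀ r q {n} → n < 4 → (r + q * 2 * 2) ⊕ n ≡ (r ⊕ n) + q * 2 * 2
[r+q*2*2]⊕n r zero    {n} n<4 = trans (cong (_⊕ n) (+-identityʳ r)) (sym (+-identityʳ (r ⊕ n)))
[r+q*2*2]⊕n r (suc q) {n} n<4 = begin
  (r + (4 + q * 2 * 2)) ⊕ n    ≡⟨ cong (_⊕ n) (swap r) ⟩
  (4 + (r + q * 2 * 2)) ⊕ n    ≡⟨ [4+m]⊕n (r + q * 2 * 2) n<4 ⟩
  4 + ((r + q * 2 * 2) ⊕ n)    ≡⟨ cong (_+_ 4) ([r+q*2*2]⊕n r q n<4) ⟩
  4 + ((r ⊕ n) + q * 2 * 2)    ≡⟨ swap (r ⊕ n) ⟨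
  (r ⊕ n) + (4 + q * 2 * 2)    ∎
  where
  open ≡-Reasoning
  swap : ∀ k → k + (4 + q * 2 * 2) ≡ 4 + (k + q * 2 * 2)
  swap k = trans (sym (+-assoc k 4 _)) (trans (cong (_+ q * 2 * 2) (+-comm k 4)) (+-assoc 4 k _))

-- Binary levels

-- Doubling carries the interval from `7 * 2 ^ k` to `7 * 2 ^ suc k` to the next one; appending a
-- bit cannot overshoot, since `suc m` is at most the upper end.
level-bit : ∀ {r m} → r < 2 → 7 ≤ m → ⌊log₂[ r + m * 2 /7]⌋ ≡ suc ⌊log₂[ m /7]⌋
level-bit {r} {m} r<2 7≤m = ⌊log₂[a/7]⌋-unique (r + m * 2) (suc k)
  (begin
    7 * 2 ^ suc k      ≡⟨ double k ⟩
    7 * 2 ^ k * 2      ≤⟨ *-monoˡ-≤ 2 (proj₁ bounds) ⟩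
    m * 2              ≤⟨ m≤n+m (m * 2) r ⟩
    r + m * 2          ∎)
  (begin-strict
    r + m * 2          <⟨ +-monoˡ-< (m * 2) r<2 ⟩
    suc m * 2          ≤⟨ *-monoˡ-≤ 2 (proj₂ bounds) ⟩
    7 * 2 ^ suc k * 2  ≡⟨ double (suc k) ⟨
    7 * 2 ^ suc (suc k) ∎)
  where
  open ≤-Reasoning
  k = ⌊log₂[ m /7]⌋
  bounds = ⌊log₂[a/7]⌋-spec m 7≤m
  double : ∀ j → 7 * 2 ^ suc j ≡ 7 * 2 ^ j * 2
  double j = trans (cong (7 *_) (*-comm 2 (2 ^ j))) (sym (*-assoc 7 (2 ^ j) 2))

7≤r+q*2 : ∀ r {q} → 7 ≤ q → 7 ≤ r + q * 2
7≤r+q*2 r {q} 7≤q = ≤-trans 7≤q (≤-trans (m≤m*n q 2) (m≤n+m (q * 2) r))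

level-block : ∀ {r q} → r < 4 → 7 ≤ q →
              ⌊log₂[ r + q * 2 * 2 /7]⌋ ≡ 2 + ⌊log₂[ q /7]⌋
level-block {r} {q} r<4 7≤q = go r r<4
  where
  bits : ∀ {s t} → s < 2 → t < 2 →
         ⌊log₂[ s + (t + q * 2) * 2 /7]⌋ ≡ 2 + ⌊log₂[ q /7]⌋
  bits {t = t} s<2 t<2 = trans (level-bit s<2 (7≤r+q*2 t 7≤q)) (cong suc (level-bit t<2 7≤q))

  0<2 : 0 < 2
  0<2 = s≤s z≤n

  1<2 : 1 < 2
  1<2 = s≤s (s≤s z≤n)

  -- For each literal `r` with bits `s` and `t`, `r + q * 2 * 2` computes to `s + (t + q * 2) * 2`.
  go : ∀ r → r < 4 → ⌊log₂[ r + q * 2 * 2 /7]⌋ ≡ 2 + ⌊log₂[ q /7]⌋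
  go 0 _ = bits 0<2 0<2
  go 1 _ = bits 1<2 0<2
  go 2 _ = bits 0<2 1<2
  go 3 _ = bits 1<2 1<2
  go (suc (suc (suc (suc _)))) (s≤s (s≤s (s≤s (s≤s ()))))

-- Both parities are recorded because, for `k = ⌊log₂[ q /7]⌋`, the members of block `q` have level
-- `2 + k` and their halves have level `suc k`.
data EvenOdd (k : ℕ) : Set where
  even : k % 2 ≡ 0 → suc k % 2 ≡ 1 → EvenOdd k
  odd  : k % 2 ≡ 1 → suc k % 2 ≡ 0 → EvenOdd k

evenOdd : ∀ k → EvenOdd k
evenOdd 0 = even refl refl
evenOdd 1 = odd refl refl
evenOdd (suc (suc k)) with evenOdd k
... | even p q = even p q
... | odd  p q = odd p q

-- The cut at 28 = 4 · 7 ensures `7 ≤ q`, so that a block member and its half are both at least 14,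
-- where the mask formulas hold.
data Blocks : ℕ → Set where
  below : ∀ {x} → x < 28 → Blocks x
  block : ∀ {r q} → r < 4 → 7 ≤ q → Blocks (r + q * 2 * 2)

blocks : ∀ x → Blocks x
blocks x with x <? 28
... | yes x<28 = below x<28
... | no  x≮28 = subst Blocks
  (sym (trans (m≡m%n+[m/n]*n x 4) (cong (_+_ (x % 4)) (sym (*-assoc (x / 4) 2 2)))))
  (block (m%n<n x 4) (/-monoˡ-≤ 4 (≮⇒≥ x≮28)))

28≤block : ∀ {r q} → 7 ≤ q → 28 ≤ r + q * 2 * 2
28≤block {r} {q} 7≤q = ≤-trans (*-monoˡ-≤ 2 (*-monoˡ-≤ 2 7≤q)) (m≤n+m (q * 2 * 2) r)

-- The involutions

-- mask₀ and mask₁ give x ⊕ φ₀ x and x ⊕ φ₁ x for x ≥ 14, from the parity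
-- of ⌊log₂[ x /7]⌋.
mask₀ mask₁ : ℕ → ℕ
mask₀ zero    = 2
mask₀ (suc _) = 0
mask₁ zero    = 3
mask₁ (suc _) = 1

-- The 𝒫-positions a¹b¹ are those with b ≡ φ₀ a.
φ₀ : ℕ → ℕ
φ₀ 0  = 0
φ₀ 1  = 2
φ₀ 2  = 1
φ₀ 3  = 3
φ₀ 4  = 4
φ₀ 5  = 5
φ₀ 6  = 8
φ₀ 7  = 9
φ₀ 8  = 6
φ₀ 9  = 7
φ₀ 10 = 12
φ₀ 11 = 13
φ₀ 12 = 10
φ₀ 13 = 11
φ₀ x  = x ⊕ mask₀ (⌊log₂[ x /7]⌋ % 2)

φ₀-≥14 : ∀ x → 14 ≤ x → φ₀ x ≡ x ⊕ mask₀ (⌊log₂[ x /7]⌋ % 2)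
φ₀-≥14 _ (s≤s (s≤s (s≤s (s≤s (s≤s (s≤s (s≤s (s≤s (s≤s (s≤s (s≤s (s≤s (s≤s (s≤s _)))))))))))))) = refl

φ₁-large≡⊕mask₁ : ∀ k x → φ₁-large k x ≡ x ⊕ mask₁ k
φ₁-large≡⊕mask₁ zero    x = refl
φ₁-large≡⊕mask₁ (suc _) x = refl

φ₁-≥14-mask : ∀ x → 14 ≤ x → φ₁ x ≡ x ⊕ mask₁ (⌊log₂[ x /7]⌋ % 2)
φ₁-≥14-mask x p = trans (φ₁-≥14 x p) (φ₁-large≡⊕mask₁ _ x)

-- "Even" refers to the level of `q`. The half `r + q * 2` then has odd level, where `mask₀`
-- vanishes.
φ₀-half-even : ∀ {r q} → r < 2 → 7 ≤ q → suc ⌊log₂[ q /7]⌋ % 2 ≡ 1 →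
               φ₀ (r + q * 2) ≡ r + q * 2
φ₀-half-even {r} {q} r<2 7≤q eq = begin
  φ₀ (r + q * 2)                                          ≡⟨ φ₀-≥14 _ (≤-trans (*-monoˡ-≤ 2 7≤q) (m≤n+m _ r)) ⟩
  (r + q * 2) ⊕ mask₀ (⌊log₂[ r + q * 2 /7]⌋ % 2)         ≡⟨ cong (λ k → (r + q * 2) ⊕ mask₀ (k % 2)) (level-bit r<2 7≤q) ⟩
  (r + q * 2) ⊕ mask₀ (suc ⌊log₂[ q /7]⌋ % 2)             ≡⟨ cong (λ k → (r + q * 2) ⊕ mask₀ k) eq ⟩
  (r + q * 2) ⊕ 0                                         ≡⟨ ⊕-identityʳ _ ⟩
  r + q * 2                                               ∎
  where open ≡-Reasoning

φ₀-half-odd : ∀ {r q} → r < 2 → 7 ≤ q → suc ⌊log₂[ q /7]⌋ % 2 ≡ 0 →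
              φ₀ (r + q * 2) ≢ r + q * 2
φ₀-half-odd {r} {q} r<2 7≤q eq fixed = m⊕2≢m (r + q * 2) (begin
  (r + q * 2) ⊕ 2                                         ≡⟨ cong (λ k → (r + q * 2) ⊕ mask₀ k) eq ⟨
  (r + q * 2) ⊕ mask₀ (suc ⌊log₂[ q /7]⌋ % 2)             ≡⟨ cong (λ k → (r + q * 2) ⊕ mask₀ (k % 2)) (level-bit r<2 7≤q) ⟨
  (r + q * 2) ⊕ mask₀ (⌊log₂[ r + q * 2 /7]⌋ % 2)         ≡⟨ φ₀-≥14 _ (≤-trans (*-monoˡ-≤ 2 7≤q) (m≤n+m _ r)) ⟨
  φ₀ (r + q * 2)                                          ≡⟨ fixed ⟩
  r + q * 2                                               ∎)
  where open ≡-Reasoning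

⌊r/2⌋<2 : ∀ {r} → r < 4 → ⌊ r /2⌋ < 2
⌊r/2⌋<2 r<4 = s≤s (⌊n/2⌋-mono (≤-pred r<4))

-- The common features of `φ₀` and `φ₁`: apart from the formula `φ-≥14`, only facts about masks,
-- residues below 4 and numbers below 28. Mask 0 flips bit 1, mask 1 does not.
record Masked (φ mask : ℕ → ℕ) : Set where
  field
    φ-≥14 : ∀ x → 14 ≤ x → φ x ≡ x ⊕ mask (⌊log₂[ x /7]⌋ % 2)
    mask<4 : ∀ k → mask k < 4
    ⊕-mask<4 : ∀ k {r} → r < 4 → r ⊕ mask k < 4
    ⊕-mask-involutive : ∀ k {r} → r < 4 → (r ⊕ mask k) ⊕ mask k ≡ r
    ⌊⊕-mask0/2⌋ : ∀ {r} → r < 4 → ⌊ r ⊕ mask 0 /2⌋ ≢ ⌊ r /2⌋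
    ⌊⊕-mask1/2⌋ : ∀ {r} → r < 4 → ⌊ r ⊕ mask 1 /2⌋ ≡ ⌊ r /2⌋
    φ<28 : ∀ {x} → x < 28 → φ x < 28
    φ-involutive<28 : ∀ {x} → x < 28 → φ (φ x) ≡ x

  φ-block : ∀ {r q} → r < 4 → 7 ≤ q →
            φ (r + q * 2 * 2) ≡ (r ⊕ mask (⌊log₂[ q /7]⌋ % 2)) + q * 2 * 2
  φ-block {r} {q} r<4 7≤q = begin
    φ x                                      ≡⟨ φ-≥14 x (≤-trans (m≤m+n 14 14) (28≤block {r} 7≤q)) ⟩
    x ⊕ mask (⌊log₂[ x /7]⌋ % 2)             ≡⟨ cong (λ k → x ⊕ mask (k % 2)) (level-block r<4 7≤q) ⟩
    x ⊕ mask (⌊log₂[ q /7]⌋ % 2)             ≡⟨ [r+q*2*2]⊕n r q (mask<4 _) ⟩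
    (r ⊕ mask (⌊log₂[ q /7]⌋ % 2)) + q * 2 * 2 ∎
    where
    open ≡-Reasoning
    x = r + q * 2 * 2

  φ-block< : ∀ {r q} → r < 4 → 7 ≤ q → φ (r + q * 2 * 2) < suc q * 2 * 2
  φ-block< {q = q} r<4 7≤q = subst (_< suc q * 2 * 2) (sym (φ-block r<4 7≤q))
    (+-monoˡ-< (q * 2 * 2) (⊕-mask<4 _ r<4))

  φ-involutive : ∀ x → φ (φ x) ≡ x
  φ-involutive x with blocks x
  ... | below x<28 = φ-involutive<28 x<28
  ... | block {r} {q} r<4 7≤q = begin
    φ (φ (r + q * 2 * 2))                  ≡⟨ cong φ (φ-block r<4 7≤q) ⟩
    φ ((r ⊕ mask t) + q * 2 * 2)           ≡⟨ φ-block (⊕-mask<4 t r<4) 7≤q ⟩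
    ((r ⊕ mask t) ⊕ mask t) + q * 2 * 2    ≡⟨ cong (_+ q * 2 * 2) (⊕-mask-involutive t r<4) ⟩
    r + q * 2 * 2                          ∎
    where
    open ≡-Reasoning
    t = ⌊log₂[ q /7]⌋ % 2

  ⌊φ-block/2⌋ : ∀ {r q t} → r < 4 → 7 ≤ q → ⌊log₂[ q /7]⌋ % 2 ≡ t →
                ⌊ φ (r + q * 2 * 2) /2⌋ ≡ ⌊ r ⊕ mask t /2⌋ + q * 2
  ⌊φ-block/2⌋ {r} {q} r<4 7≤q refl =
    trans (cong ⌊_/2⌋ (φ-block r<4 7≤q)) (⌊r+m*2/2⌋ (r ⊕ mask _) (q * 2))

  -- Halving swaps the two parities of the level, so exactly one of φ and
  -- φ₀ ∘ ⌊_/2⌋ changes bit 1 of x, which is bit 0 of ⌊ x /2⌋.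
  halve-block≢ : ∀ {r q} → r < 4 → 7 ≤ q →
                 φ₀ ⌊ r + q * 2 * 2 /2⌋ ≢ ⌊ φ (r + q * 2 * 2) /2⌋
  halve-block≢ {r} {q} r<4 7≤q eq with evenOdd ⌊log₂[ q /7]⌋
  ... | even p p′ = ⌊⊕-mask0/2⌋ r<4 (+-cancelʳ-≡ (q * 2) _ _ (begin
    ⌊ r ⊕ mask 0 /2⌋ + q * 2      ≡⟨ ⌊φ-block/2⌋ r<4 7≤q p ⟨
    ⌊ φ (r + q * 2 * 2) /2⌋       ≡⟨ eq ⟨
    φ₀ ⌊ r + q * 2 * 2 /2⌋        ≡⟨ cong φ₀ (⌊r+m*2/2⌋ r (q * 2)) ⟩
    φ₀ (⌊ r /2⌋ + q * 2)          ≡⟨ φ₀-half-even (⌊r/2⌋<2 r<4) 7≤q p′ ⟩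
    ⌊ r /2⌋ + q * 2               ∎))
    where open ≡-Reasoning
  ... | odd p p′ = φ₀-half-odd (⌊r/2⌋<2 r<4) 7≤q p′ (begin
    φ₀ (⌊ r /2⌋ + q * 2)          ≡⟨ cong φ₀ (⌊r+m*2/2⌋ r (q * 2)) ⟨
    φ₀ ⌊ r + q * 2 * 2 /2⌋        ≡⟨ eq ⟩
    ⌊ φ (r + q * 2 * 2) /2⌋       ≡⟨ ⌊φ-block/2⌋ r<4 7≤q p ⟩
    ⌊ r ⊕ mask 1 /2⌋ + q * 2      ≡⟨ cong (_+ q * 2) (⌊⊕-mask1/2⌋ r<4) ⟩
    ⌊ r /2⌋ + q * 2               ∎)
    where open ≡-Reasoning

  -- Two numbers each below the image of the other lie in the same block
  -- of four.
  crossing : (P : ℕ → ℕ → Set) →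
    (∀ {a} → a < 28 → ∀ {b} → b < 28 → b < φ a → a < φ b → P a b) →
    (∀ {r s q t} → r < 4 → s < 4 → 7 ≤ q → ⌊log₂[ q /7]⌋ % 2 ≡ t →
      s < r ⊕ mask t → r < s ⊕ mask t → P (r + q * 2 * 2) (s + q * 2 * 2)) →
    ∀ a b → b < φ a → a < φ b → P a b
  crossing P small large a b b<φa a<φb with blocks a | blocks b
  ... | below a<28    | below b<28 = small a<28 b<28 b<φa a<φb
  ... | below a<28    | block {s} s<4 7≤q =
    contradiction (28≤block {s} 7≤q) (<⇒≱ (<-trans b<φa (φ<28 a<28)))
  ... | block {r} r<4 7≤q | below b<28 =
    contradiction (28≤block {r} 7≤q) (<⇒≱ (<-trans a<φb (φ<28 b<28)))
  ... | block {r} {q} r<4 7≤q | block {s} {q′} s<4 7≤q′ with <-cmp q q′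
  -- `φ` preserves the block of `a`, so `b < φ a` keeps `b` out of later blocks.
  ...   | tri< q<q′ _ _ = contradiction
    (≤-trans (*-monoˡ-≤ 2 (*-monoˡ-≤ 2 q<q′)) (m≤n+m (q′ * 2 * 2) s))
    (<⇒≱ (<-trans b<φa (φ-block< r<4 7≤q)))
  ...   | tri> _ _ q′<q = contradiction
    (≤-trans (*-monoˡ-≤ 2 (*-monoˡ-≤ 2 q′<q)) (m≤n+m (q * 2 * 2) r))
    (<⇒≱ (<-trans a<φb (φ-block< s<4 7≤q′)))
  ...   | tri≈ _ refl _ = large r<4 s<4 7≤q refl
    (+-cancelʳ-< (q * 2 * 2) _ _ (subst (s + q * 2 * 2 <_) (φ-block r<4 7≤q) b<φa))
    (+-cancelʳ-< (q * 2 * 2) _ _ (subst (r + q * 2 * 2 <_) (φ-block s<4 7≤q) a<φb))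

-- Finite checks for the two involutions

⊕<4 : ∀ {k} → k < 4 → ∀ {r} → r < 4 → r ⊕ k < 4
⊕<4 = from-yes (allUpTo? (λ k → allUpTo? (λ r → r ⊕ k <? 4) 4) 4)

⊕-involutive<4 : ∀ {k} → k < 4 → ∀ {r} → r < 4 → (r ⊕ k) ⊕ k ≡ r
⊕-involutive<4 = from-yes (allUpTo? (λ k → allUpTo? (λ r → (r ⊕ k) ⊕ k ≟ r) 4) 4)

mask₀<4 : ∀ k → mask₀ k < 4
mask₀<4 zero    = s≤s (s≤s (s≤s z≤n))
mask₀<4 (suc _) = s≤s z≤n

mask₁<4 : ∀ k → mask₁ k < 4
mask₁<4 zero    = s≤s (s≤s (s≤s (s≤s z≤n)))
mask₁<4 (suc _) = s≤s (s≤s z≤n)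

φ₀-masked : Masked φ₀ mask₀
φ₀-masked = record
  { φ-≥14             = φ₀-≥14
  ; mask<4            = mask₀<4
  ; ⊕-mask<4          = λ k → ⊕<4 (mask₀<4 k)
  ; ⊕-mask-involutive = λ k → ⊕-involutive<4 (mask₀<4 k)
  ; ⌊⊕-mask0/2⌋       = from-yes (allUpTo? (λ r → ¬? (⌊ r ⊕ 2 /2⌋ ≟ ⌊ r /2⌋)) 4)
  ; ⌊⊕-mask1/2⌋       = from-yes (allUpTo? (λ r → ⌊ r ⊕ 0 /2⌋ ≟ ⌊ r /2⌋) 4)
  ; φ<28              = from-yes (allUpTo? (λ x → φ₀ x <? 28) 28)
  ; φ-involutive<28   = from-yes (allUpTo? (λ x → φ₀ (φ₀ x) ≟ x) 28)
  }

φ₁-masked : Masked φ₁ mask₁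
φ₁-masked = record
  { φ-≥14             = φ₁-≥14-mask
  ; mask<4            = mask₁<4
  ; ⊕-mask<4          = λ k → ⊕<4 (mask₁<4 k)
  ; ⊕-mask-involutive = λ k → ⊕-involutive<4 (mask₁<4 k)
  ; ⌊⊕-mask0/2⌋       = from-yes (allUpTo? (λ r → ¬? (⌊ r ⊕ 3 /2⌋ ≟ ⌊ r /2⌋)) 4)
  ; ⌊⊕-mask1/2⌋       = from-yes (allUpTo? (λ r → ⌊ r ⊕ 1 /2⌋ ≟ ⌊ r /2⌋) 4)
  ; φ<28              = from-yes (allUpTo? (λ x → φ₁ x <? 28) 28)
  ; φ-involutive<28   = from-yes (allUpTo? (λ x → φ₁ (φ₁ x) ≟ x) 28)
  }

-- Halving, the third pile and crossing pairs

module M₀ = Masked φ₀-masked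
module M₁ = Masked φ₁-masked

-- Keeps halving from joining two 𝒫-positions. At `a = 0` equality holds, but the position
-- `(0 , φ₀ 0)` has no coins and cannot be halved.
φ₀-halve≢ : ∀ a → 0 < a → φ₀ ⌊ a /2⌋ ≢ ⌊ φ₀ a /2⌋
φ₀-halve≢ a 0<a with blocks a
... | below a<28    = from-yes (allUpTo?
  (λ x → (0 <? x) →-dec ¬? (φ₀ ⌊ x /2⌋ ≟ ⌊ φ₀ x /2⌋)) 28) a<28 0<a
... | block r<4 7≤q = M₀.halve-block≢ r<4 7≤q

φ₁-halve≢ : ∀ a → φ₀ ⌊ a /2⌋ ≢ ⌊ φ₁ a /2⌋
φ₁-halve≢ a with blocks a
... | below a<28    = from-yes (allUpTo? (λ x → ¬? (φ₀ ⌊ x /2⌋ ≟ ⌊ φ₁ x /2⌋)) 28) a<28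
... | block r<4 7≤q = M₁.halve-block≢ r<4 7≤q

-- Keeps emptying the third pile from joining two 𝒫-positions. Within a block the masks are 2 and 3,
-- or 0 and 1.
φ₀≢φ₁ : ∀ a → φ₀ a ≢ φ₁ a
φ₀≢φ₁ a eq with blocks a
... | below a<28 = from-yes (allUpTo? (λ x → ¬? (φ₀ x ≟ φ₁ x)) 28) a<28 eq
... | block {r} {q} r<4 7≤q = masks-differ ⌊log₂[ q /7]⌋
  (+-cancelʳ-≡ (q * 2 * 2) _ _
    (trans (sym (M₀.φ-block r<4 7≤q)) (trans eq (M₁.φ-block r<4 7≤q))))
  where
  masks-differ : ∀ k → r ⊕ mask₀ (k % 2) ≢ r ⊕ mask₁ (k % 2)
  masks-differ k with k % 2
  ... | zero  = from-yes (allUpTo? (λ r → ¬? (r ⊕ 2 ≟ r ⊕ 3)) 4) r<4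
  ... | suc _ = from-yes (allUpTo? (λ r → ¬? (r ⊕ 0 ≟ r ⊕ 1)) 4) r<4

-- Members of the block that agree in bit 1 have the same half, and at this level `φ₀` fixes it;
-- halving such a pair reaches a 𝒫-position.
φ₀-half-even-block : ∀ {r s q} → r < 4 → 7 ≤ q → suc ⌊log₂[ q /7]⌋ % 2 ≡ 1 →
  ⌊ r /2⌋ ≡ ⌊ s /2⌋ → φ₀ ⌊ r + q * 2 * 2 /2⌋ ≡ ⌊ s + q * 2 * 2 /2⌋
φ₀-half-even-block {r} {s} {q} r<4 7≤q p eq = begin
  φ₀ ⌊ r + q * 2 * 2 /2⌋    ≡⟨ cong φ₀ (⌊r+m*2/2⌋ r (q * 2)) ⟩
  φ₀ (⌊ r /2⌋ + q * 2)      ≡⟨ φ₀-half-even (⌊r/2⌋<2 r<4) 7≤q p ⟩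
  ⌊ r /2⌋ + q * 2           ≡⟨ cong (_+ q * 2) eq ⟩
  ⌊ s /2⌋ + q * 2           ≡⟨ ⌊r+m*2/2⌋ s (q * 2) ⟨
  ⌊ s + q * 2 * 2 /2⌋       ∎
  where open ≡-Reasoning

φ₀-crossing : ∀ a b → b < φ₀ a → a < φ₀ b → φ₀ ⌊ a /2⌋ ≡ ⌊ b /2⌋
φ₀-crossing = M₀.crossing (λ a b → φ₀ ⌊ a /2⌋ ≡ ⌊ b /2⌋)
  (from-yes (allUpTo? (λ a → allUpTo? (λ b →
    (b <? φ₀ a) →-dec ((a <? φ₀ b) →-dec (φ₀ ⌊ a /2⌋ ≟ ⌊ b /2⌋))) 28) 28))
  large
  where
  large : ∀ {r s q t} → r < 4 → s < 4 → 7 ≤ q → ⌊log₂[ q /7]⌋ % 2 ≡ t →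
    s < r ⊕ mask₀ t → r < s ⊕ mask₀ t → φ₀ ⌊ r + q * 2 * 2 /2⌋ ≡ ⌊ s + q * 2 * 2 /2⌋
  large {r} {s} {q} r<4 s<4 7≤q refl s< r< with evenOdd ⌊log₂[ q /7]⌋
  -- Under mask 2 the two inequalities force bit 1 of both `r` and `s` to be 0.
  ... | even p p′ rewrite p = φ₀-half-even-block {r} {s} r<4 7≤q p′
    (from-yes (allUpTo? (λ r → allUpTo? (λ s →
      (s <? r ⊕ 2) →-dec ((r <? s ⊕ 2) →-dec (⌊ r /2⌋ ≟ ⌊ s /2⌋))) 4) 4) r<4 s<4 s< r<)
  -- Under mask 0 the inequalities read `s < r` and `r < s`.
  ... | odd p _ rewrite p = contradiction
    (subst (r <_) (⊕-identityʳ s) r<) (<-asym (subst (s <_) (⊕-identityʳ r) s<))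

-- Each alternative is a winning move: emptying the third pile, or halving, which also turns the
-- third pile from 1 to 0.
φ₁-crossing : ∀ a b → b < φ₁ a → a < φ₁ b → φ₀ a ≡ b ⊎ φ₀ ⌊ a /2⌋ ≡ ⌊ b /2⌋
φ₁-crossing = M₁.crossing (λ a b → φ₀ a ≡ b ⊎ φ₀ ⌊ a /2⌋ ≡ ⌊ b /2⌋)
  (from-yes (allUpTo? (λ a → allUpTo? (λ b →
    (b <? φ₁ a) →-dec ((a <? φ₁ b) →-dec
      ((φ₀ a ≟ b) ⊎-dec (φ₀ ⌊ a /2⌋ ≟ ⌊ b /2⌋)))) 28) 28))
  large
  where
  φ₀≡ : ∀ {r s q t} → r < 4 → 7 ≤ q → ⌊log₂[ q /7]⌋ % 2 ≡ t → r ⊕ mask₀ t ≡ s →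
        φ₀ (r + q * 2 * 2) ≡ s + q * 2 * 2
  φ₀≡ {q = q} r<4 7≤q refl eq = trans (M₀.φ-block r<4 7≤q) (cong (_+ q * 2 * 2) eq)

  large : ∀ {r s q t} → r < 4 → s < 4 → 7 ≤ q → ⌊log₂[ q /7]⌋ % 2 ≡ t →
    s < r ⊕ mask₁ t → r < s ⊕ mask₁ t →
    φ₀ (r + q * 2 * 2) ≡ s + q * 2 * 2 ⊎
    φ₀ ⌊ r + q * 2 * 2 /2⌋ ≡ ⌊ s + q * 2 * 2 /2⌋
  large {r} {s} {q} r<4 s<4 7≤q refl s< r< with evenOdd ⌊log₂[ q /7]⌋
  -- Under mask 1 the inequalities force `r` and `s` to be equal, and `φ₀` fixes this block.
  ... | odd p _ rewrite p = inj₁ (φ₀≡ {r} r<4 7≤q p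
    (from-yes (allUpTo? (λ r → allUpTo? (λ s →
      (s <? r ⊕ 1) →-dec ((r <? s ⊕ 1) →-dec (r ⊕ 0 ≟ s))) 4) 4) r<4 s<4 s< r<))
  -- Under mask 3 the surviving pairs either differ exactly in bit 1, which is `mask₀` at this
  -- level, or agree in it.
  ... | even p p′ rewrite p
    with from-yes (allUpTo? (λ r → allUpTo? (λ s →
      (s <? r ⊕ 3) →-dec ((r <? s ⊕ 3) →-dec
        ((r ⊕ 2 ≟ s) ⊎-dec (⌊ r /2⌋ ≟ ⌊ s /2⌋)))) 4) 4) r<4 s<4 s< r<
  ...   | inj₁ eq = inj₁ (φ₀≡ {r} r<4 7≤q p eq)
  ...   | inj₂ eq = inj₂ (φ₀-half-even-block {r} {s} r<4 7≤q p′ eq)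

-- The game

P⇒¬N : ∀ {ps} → P-position ps → ¬ N-position ps
P⇒¬N (allMovesToN f) (someMoveToP m p) = P⇒¬N p (f m)

record Solved (φ : ℕ → ℕ) (c a b : ℕ) : Set where
  constructor solved
  field
    P : b ≡ φ a → P-position (a ∷ b ∷ c ∷ [])
    N : b ≢ φ a → N-position (a ∷ b ∷ c ∷ [])

open Solved

-- Lowering either of the first two piles decreases `a + b`, so `smaller` judges those moves; the
-- moves that can change `c` are left to the other hypotheses.
solve : ∀ {φ} → (∀ x → φ (φ x) ≡ x) → ∀ {a b c} →
  (∀ {a′ b′} → a′ + b′ < a + b → Solved φ c a′ b′) →
  (b ≡ φ a → ∀ {c′} → c′ < c → N-position (a ∷ b ∷ c′ ∷ [])) →
  (b ≡ φ a → Any (0 <_) (a ∷ b ∷ c ∷ []) →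
    N-position (map ⌊_/2⌋ (a ∷ b ∷ c ∷ []))) →
  (b < φ a → a < φ b → N-position (a ∷ b ∷ c ∷ [])) →
  Solved φ c a b
solve {φ} involutive {a} {b} {c} smaller third halved cross = solved isP isN
  where
  injective : ∀ {x y} → φ x ≡ φ y → x ≡ y
  injective {x} {y} eq = trans (sym (involutive x)) (trans (cong φ eq) (involutive y))

  isP : b ≡ φ a → P-position (a ∷ b ∷ c ∷ [])
  isP eq = allMovesToN λ where
    (take (here a′<a)) → N (smaller (+-monoˡ-< b a′<a))
      λ eq′ → <⇒≢ a′<a (injective (trans (sym eq′) eq))
    (take (there (here b′<b))) → N (smaller (+-monoʳ-< a b′<b))
      λ eq′ → <⇒≢ b′<b (trans eq′ (sym eq))
    (take (there (there (here c′<c)))) → third eq c′<c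
    (halve any) → halved eq any

  isN : b ≢ φ a → N-position (a ∷ b ∷ c ∷ [])
  isN b≢φa with <-cmp b (φ a)
  ... | tri≈ _ b≡φa _ = contradiction b≡φa b≢φa
  ... | tri> _ _ φa<b = someMoveToP (take (there (here φa<b)))
    (P (smaller (+-monoʳ-< a φa<b)) refl)
  ... | tri< b<φa _ _ with <-cmp a (φ b)
  ...   | tri< a<φb _ _ = cross b<φa a<φb
  ...   | tri≈ _ a≡φb _ = contradiction (trans (sym (involutive b)) (cong φ (sym a≡φb))) b≢φa
  -- As `φ` is an involution, lowering `a` to `φ b` lands on its graph.
  ...   | tri> _ _ φb<a = someMoveToP (take (here φb<a))
    (P (smaller (+-monoˡ-< b φb<a)) (sym (involutive b)))

halves-< : ∀ {a} b → 0 < a → ⌊ a /2⌋ + ⌊ b /2⌋ < a + b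
halves-< {suc a} b _ = +-mono-<-≤ (⌊n/2⌋<n a) (⌊n/2⌋≤n b)

-- The empty third pile stays empty under halving, so induction on `a + b` covers every move.
-- Keeping it in the list makes these the very positions reached from a third pile of 1.
solved₀ : ∀ a b → Solved φ₀ 0 a b
solved₀ a b = go a b (<-wellFounded (a + b))
  where
  go : ∀ a b → Acc _<_ (a + b) → Solved φ₀ 0 a b
  go a b (acc rs) = solve M₀.φ-involutive smaller (λ _ ()) halved cross
    where
    smaller : ∀ {a′ b′} → a′ + b′ < a + b → Solved φ₀ 0 a′ b′
    smaller lt = go _ _ (rs lt)

    halved : b ≡ φ₀ a → Any (0 <_) (a ∷ b ∷ 0 ∷ []) →
             N-position (⌊ a /2⌋ ∷ ⌊ b /2⌋ ∷ 0 ∷ [])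
    halved refl any = N (smaller (halves-< b 0<a)) (φ₀-halve≢ a 0<a ∘ sym)
      where
      positive : ∀ a → Any (0 <_) (a ∷ φ₀ a ∷ 0 ∷ []) → 0 < a
      positive (suc _) _                  = s≤s z≤n
      positive zero    (here ())
      positive zero    (there (here ()))
      positive zero    (there (there (here ())))
      0<a = positive a any

    cross : b < φ₀ a → a < φ₀ b → N-position (a ∷ b ∷ 0 ∷ [])
    cross b<φ₀a a<φ₀b = someMoveToP (halve (here 0<a))
      (P (smaller (halves-< b 0<a)) (sym (φ₀-crossing a b b<φ₀a a<φ₀b)))
      where
      -- The case `a = 0` is void because `φ₀ 0` is 0.
      positive : ∀ a → b < φ₀ a → 0 < a
      positive (suc _) _ = s≤s z≤n
      0<a = positive a b<φ₀a

-- Only moves in the first two piles keep the third at 1; all others are judged by `solved₀`,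
-- without induction.
solved₁ : ∀ a b → Solved φ₁ 1 a b
solved₁ a b = go a b (<-wellFounded (a + b))
  where
  go : ∀ a b → Acc _<_ (a + b) → Solved φ₁ 1 a b
  go a b (acc rs) = solve M₁.φ-involutive (λ lt → go _ _ (rs lt)) third halved cross
    where
    third : b ≡ φ₁ a → ∀ {c′} → c′ < 1 → N-position (a ∷ b ∷ c′ ∷ [])
    third refl (s≤s z≤n) = N (solved₀ a b) (φ₀≢φ₁ a ∘ sym)

    halved : b ≡ φ₁ a → Any (0 <_) (a ∷ b ∷ 1 ∷ []) →
             N-position (⌊ a /2⌋ ∷ ⌊ b /2⌋ ∷ 0 ∷ [])
    halved refl _ = N (solved₀ ⌊ a /2⌋ ⌊ b /2⌋) (φ₁-halve≢ a ∘ sym)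

    cross : b < φ₁ a → a < φ₁ b → N-position (a ∷ b ∷ 1 ∷ [])
    cross b<φ₁a a<φ₁b with φ₁-crossing a b b<φ₁a a<φ₁b
    ... | inj₁ eq = someMoveToP (take (there (there (here (s≤s z≤n)))))
      (P (solved₀ a b) (sym eq))
    ... | inj₂ eq = someMoveToP (halve (there (there (here (s≤s z≤n)))))
      (P (solved₀ ⌊ a /2⌋ ⌊ b /2⌋) (sym eq))

P⇔φ₁ : ∀ a b → P-position (a ∷ b ∷ 1 ∷ []) ⇔ (b ≡ φ₁ a)
P⇔φ₁ a b = mk⇔ to (P (solved₁ a b))
  where
  to : P-position (a ∷ b ∷ 1 ∷ []) → b ≡ φ₁ a
  to p with b ≟ φ₁ a
  ... | yes eq = eq
  ... | no neq = contradiction (N (solved₁ a b) neq) (P⇒¬N p)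

-- Uniqueness of φ₁ and the exclusive-or criterion

map-≡⇒∈-≡ : ∀ {A B : Set} {f g : A → B} {xs x} → map f xs ≡ map g xs → x ∈ xs → f x ≡ g x
map-≡⇒∈-≡ eq (here refl)  = ∷-injectiveˡ eq
map-≡⇒∈-≡ eq (there x∈xs) = map-≡⇒∈-≡ (∷-injectiveʳ eq) x∈xs

-- The two forms are the lower exponents of the ranges in `Isφ₁`, with `n = suc m`.
odd-or-even : ∀ j → ∃ λ m → suc j ≡ 2 * suc m ∸ 1 ⊎ suc j ≡ 2 * suc m
odd-or-even 0 = 0 , inj₁ refl
odd-or-even 1 = 0 , inj₂ refl
odd-or-even (suc (suc j)) with odd-or-even j
... | m , inj₁ eq = suc m , inj₁ (trans (cong (_+_ 2) eq) (cong (_∸ 1) (sym (*-suc 2 (suc m)))))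
... | m , inj₂ eq = suc m , inj₂ (trans (cong (_+_ 2) eq) (sym (*-suc 2 (suc m))))

Isφ₁-unique : ∀ {φ ψ} → Isφ₁ φ → Isφ₁ ψ → ∀ a → φ a ≡ ψ a
Isφ₁-unique {φ} {ψ} isφ isψ a with a <? 14
... | yes a<14 = map-≡⇒∈-≡ {f = φ} {g = ψ} (trans (initial isφ) (sym (initial isψ))) (∈-upTo⁺ a<14)
  where open Isφ₁
... | no  a≮14 = go ⌊log₂[ a /7]⌋ refl
  where
  open Isφ₁
  a≥14 = ≮⇒≥ a≮14
  bounds = ⌊log₂[a/7]⌋-spec a (≤-trans (m≤m+n 7 7) a≥14)

  go : ∀ k → ⌊log₂[ a /7]⌋ ≡ k → φ a ≡ ψ a
  -- Level 0 would give `a < 14`.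
  go zero eq = contradiction (subst (λ k → a < 7 * 2 ^ suc k) eq (proj₂ bounds)) (≤⇒≯ a≥14)
  go (suc j) eq with odd-or-even j
  ... | m , inj₁ eq′ = trans (xor-1 isφ (suc m) a (s≤s z≤n) lo hi)
                             (sym (xor-1 isψ (suc m) a (s≤s z≤n) lo hi))
    where
    lo = subst (λ k → 7 * 2 ^ k ≤ a) (trans eq eq′) (proj₁ bounds)
    hi = subst (λ k → a < 7 * 2 ^ suc k) (trans eq eq′) (proj₂ bounds)
  ... | m , inj₂ eq′ = trans (xor-3 isφ (suc m) a (s≤s z≤n) lo hi)
                             (sym (xor-3 isψ (suc m) a (s≤s z≤n) lo hi))
    where
    lo = subst (λ k → 7 * 2 ^ k ≤ a) (trans eq eq′) (proj₁ bounds)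
    hi = subst (λ k → a < 7 * 2 ^ k) (trans (cong suc (trans eq eq′)) (+-comm 1 (2 * suc m)))
           (proj₂ bounds)

-- Only the parity of `k` matters: the value is 3 at even and 1 at odd levels.
2+-1^k≡mask₁ : ∀ k → + 2 ℤ.+ -1ℤ ℤ.^ k ≡ + mask₁ (k % 2)
2+-1^k≡mask₁ 0 = refl
2+-1^k≡mask₁ 1 = refl
2+-1^k≡mask₁ (suc (suc k)) = trans (cong (ℤ._+_ (+ 2)) square) (2+-1^k≡mask₁ k)
  where
  square : -1ℤ ℤ.* (-1ℤ ℤ.* -1ℤ ℤ.^ k) ≡ -1ℤ ℤ.^ k
  square = trans (sym (ℤ.*-assoc -1ℤ -1ℤ (-1ℤ ℤ.^ k))) (ℤ.*-identityˡ (-1ℤ ℤ.^ k))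

-- `a ⊕_` is its own inverse, so `b ≡ a ⊕ mask` and `a ⊕ b ≡ mask` are interchangeable.
φ₁⇔xor : ∀ a b → a ≥ 14 → (b ≡ φ₁ a) ⇔ (+ (a ⊕ b) ≡ + 2 ℤ.+ -1ℤ ℤ.^ ⌊log₂[ a /7]⌋)
φ₁⇔xor a b a≥14 = mk⇔ to from
  where
  k = ⌊log₂[ a /7]⌋

  to : b ≡ φ₁ a → + (a ⊕ b) ≡ + 2 ℤ.+ -1ℤ ℤ.^ k
  to refl = trans
    (cong +_ (trans (cong (a ⊕_) (φ₁-≥14-mask a a≥14)) (m⊕[m⊕n]≡n a (mask₁ (k % 2)))))
    (sym (2+-1^k≡mask₁ k))

  from : + (a ⊕ b) ≡ + 2 ℤ.+ -1ℤ ℤ.^ k → b ≡ φ₁ a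
  from eq = begin
    b                        ≡⟨ m⊕[m⊕n]≡n a b ⟨
    a ⊕ (a ⊕ b)              ≡⟨ cong (a ⊕_) (ℤ.+-injective (trans eq (2+-1^k≡mask₁ k))) ⟩
    a ⊕ mask₁ (k % 2)        ≡⟨ φ₁-≥14-mask a a≥14 ⟨
    φ₁ a                     ∎
    where open ≡-Reasoning

theorem15 : (∀ (φ : ℕ → ℕ) → Isφ₁ φ →
    ∀ (a b : ℕ) → P-position (a ∷ b ∷ 1 ∷ []) ⇔ (b ≡ φ a))
    ×
    (∀ (a b : ℕ) → a ≥ 14 → b ≥ 14 →
    P-position (a ∷ b ∷ 1 ∷ []) ⇔
    (+ (a ⊕ b) ≡ + 2 ℤ.+ -1ℤ ℤ.^ ⌊log₂[ a /7]⌋))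
theorem15 =
  (λ φ isφ a b → subst (λ v → P-position (a ∷ b ∷ 1 ∷ []) ⇔ (b ≡ v))
    (Isφ₁-unique φ₁-Isφ₁ isφ a) (P⇔φ₁ a b)) ,
  (λ a b a≥14 _ → φ₁⇔xor a b a≥14 ⇔-∘ P⇔φ₁ a b)
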